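{- Let $t\ge1$, $k\ge t$, and let $v_1,v_2,\eta,\mu$ be positive integers such that there exist $\mu$ pairwise compatible simple COA$_\eta(t,k,v_2)$'s. Suppose there are non-negative integers $m_1,\dots,m_r$ and positive integers $\mu_1,\dots,\mu_r,\lambda_1,\dots,\lambda_r$ such that (1) $m_1\mu_1+\cdots+m_r\mu_r\le\mu$, and (2) for each $1\le i\le r$ a $\mu_i$-row-divisible COA$_{\lambda_i}(t,k,v_1)$ exists. Then a simple COA$_{\eta(m_1\lambda_1+\cdots+m_r\lambda_r)}(t,k,v_1v_2)$ exists (provided $m_1\lambda_1+\cdots+m_r\lambda_r\ge1$).
   Context: A COA$_\lambda(t,k,v)$ is a $\lambda v^t\times k$ array over a $v$-set $V$ in which every set of $t$ consecutive columns contains every $t$-tuple exactly $\lambda$ times as a row. An array (not necessarily a COA) has the simple property if for any two distinct sets of $t$ consecutive columns sharing exactly $i$ columns ($0\le i\le t-1$), the subarray on the $2t-i$ columns of their union contains each $(2t-i)$-tuple at most once as a row; a simple COA is a COA with this property. A COA$_\lambda(t,k,v)$ is $\mu$-row-divisible if its rows can be partitioned into $\mu$ subarrays each having the simple property. Two simple COAs over the same symbol set are compatible if the array obtained by stacking all rows of both (their superimposition) is a simple COA; a family of simple COAs over the same symbol set is compatible if its members are pairwise compatible. -}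

module Defs where

open import Data.Bool.Base using (true; false)
open import Data.Fin.Base using (Fin; toℕ)
import Data.Fin.Properties as Fin
open import Data.Fin.Subset using (Subset; ∣_∣; _∈_; _∪_)
open import Data.Nat.Base using (ℕ; _+_; _*_; _^_; _≤_; _<_)
open import Data.Nat.Properties using (+-0-monoid)
open import Data.Product using (Σ-syntax; ∃-syntax; ∃!; _×_)
open import Data.Vec.Base using (Vec; []; _∷_; _++_; map; count)
open import Data.Vec.Properties using (≡-dec)
open import Function.Bundles using (_⇔_)
open import Relation.Binary.PropositionalEquality.Core using (_≡_; _≢_)

open import Algebra.Properties.Monoid.Sum +-0-monoid public using (sum-syntax)

Row : ℕ → ℕ → Set
Row k v = Vec (Fin v) k

Array : ℕ → ℕ → ℕ → Set
Array N k v = Vec (Row k v) N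

-- The entries at the positions in S, in their original order.
restrict : ∀ {A : Set} {n} (S : Subset n) → Vec A n → Vec A ∣ S ∣
restrict []          []       = []
restrict (true  ∷ S) (x ∷ xs) = x ∷ restrict S xs
restrict (false ∷ S) (x ∷ xs) = restrict S xs

onColumns : ∀ {N k v} (S : Subset k) → Array N k v → Array N ∣ S ∣ v
onColumns S = map (restrict S)

onRows : ∀ {N k v} (P : Subset N) → Array N k v → Array ∣ P ∣ k v
onRows = restrict

occurrences : ∀ {N k v} → Row k v → Array N k v → ℕ
occurrences τ = count (λ row → ≡-dec Fin._≟_ row τ)

-- S = {s, s+1, …, s+t-1} for some s; in particular ∣ S ∣ ≡ t.
-- Columns do not wrap around.
Consecutive : ∀ {k} → ℕ → Subset k → Set
Consecutive {k} t S =
  ∃[ s ] (s + t ≤ k × (∀ (j : Fin k) → j ∈ S ⇔ (s ≤ toℕ j × toℕ j < s + t)))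

record IsCOA (l t : ℕ) {N k v : ℕ} (A : Array N k v) : Set where
  field
    size     : N ≡ l * v ^ t
    balanced : ∀ (S : Subset k) → Consecutive t S →
               ∀ (τ : Row ∣ S ∣ v) → occurrences τ (onColumns S A) ≡ l

-- Distinct sets of t consecutive columns share exactly i columns for a unique
-- i ≤ t - 1, and their union then has 2t - i columns, so i need not be mentioned.
HasSimpleProperty : ∀ {N k v} → ℕ → Array N k v → Set
HasSimpleProperty {k = k} {v} t A =
  ∀ (S S′ : Subset k) → Consecutive t S → Consecutive t S′ → S ≢ S′ →
  ∀ (τ : Row ∣ S ∪ S′ ∣ v) → occurrences τ (onColumns (S ∪ S′) A) ≤ 1

record IsSimpleCOA (l t : ℕ) {N k v : ℕ} (A : Array N k v) : Set where
  field
    isCOA  : IsCOA l t A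
    simple : HasSimpleProperty t A

-- Parts may be empty. An empty array has the simple property, so this only
-- means that fewer than μ non-empty parts are also allowed.
IsPartition : ∀ {N μ} → (Fin μ → Subset N) → Set
IsPartition P = ∀ i → ∃! _≡_ (λ c → i ∈ P c)

RowDivisible : ∀ {N k v} → (μ t : ℕ) → Array N k v → Set
RowDivisible {N} μ t A =
  Σ[ P ∈ (Fin μ → Subset N) ]
    (IsPartition P × (∀ c → HasSimpleProperty t (onRows (P c) A)))

-- To be used for arrays that are themselves simple COAs.
Compatible : ∀ {M N k v} → ℕ → Array M k v → Array N k v → Set
Compatible t A B = ∃[ l ] IsSimpleCOA l t (A ++ B)

-- The members are indexed: the same array in two positions has to be
-- compatible with itself.
record IsCompatibleFamily (l t : ℕ) {N k v μ : ℕ} (B : Fin μ → Array N k v) : Set where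
  field
    isSimpleCOA : ∀ j → IsSimpleCOA l t (B j)
    compatible  : ∀ j j′ → j ≢ j′ → Compatible t (B j) (B j′)

SimpleCOAExists : (l t k v : ℕ) → Set
SimpleCOAExists l t k v = Σ[ A ∈ Array (l * v ^ t) k v ] IsSimpleCOA l t A

RowDivisibleCOAExists : (μ l t k v : ℕ) → Set
RowDivisibleCOAExists μ l t k v =
  Σ[ A ∈ Array (l * v ^ t) k v ] (IsCOA l t A × RowDivisible μ t A)

CompatibleSimpleCOAsExist : (μ l t k v : ℕ) → Set
CompatibleSimpleCOAsExist μ l t k v =
  Σ[ B ∈ (Fin μ → Array (l * v ^ t) k v) ] IsCompatibleFamily l t B

{-# OPTIONS --safe #-}
-- Colour the rows of a μ-row-divisible COA by the part they lie in. Stacking coloured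
-- COAs with disjoint colours adds both the indices and the numbers of colours, so m i copies
-- of the i-th given COA, for all i, form a coloured COA with ∑ m i * μs i ≤ μ colours.
-- Replace each row x of colour c by the rows (x , y), with y running through the c-th
-- compatible simple COA B c. A (2t-i)-tuple of pairs (τ₁ , τ₂) then occurs
-- ∑ [x matches τ₁] * #(τ₂ in B c) times, the sum being over the coloured rows (c , x).
-- By compatibility at most one B c contains τ₂, and only once, and within colour c at
-- most one row matches τ₁, so the sum is at most 1.
module Submission where

open import Defs
open import Data.Bool.Base using (if_then_else_; true; false)
open import Data.Fin.Base using (Fin; zero; suc; _↑ˡ_; _↑ʳ_; splitAt; combine; quotient; remainder; inject≤)
import Data.Fin.Properties as Fin
open import Data.Fin.Subset using (Subset; ∣_∣; _∈_; _∪_)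
open import Data.Fin.Subset.Properties using (drop-there)
open import Data.Nat.Base using (ℕ; zero; suc; _+_; _*_; _^_; _≤_; z≤n; s≤s)
open import Data.Nat.Properties
open import Algebra.Properties.CommutativeSemigroup *-commutativeSemigroup using (interchange)
open import Data.Product using (_×_; _,_; proj₁; proj₂; map₁)
open import Data.Sum.Base using (inj₁; inj₂)
open import Data.Vec.Base using (Vec; []; _∷_; _++_; map; count; sum; concat; zipWith; tabulate; lookup)
open import Data.Vec.Properties using (≡-dec; map-∘; map-cong; map-++; sum-++; ∷-injective)
open import Function.Base using (_∘_)
open import Relation.Binary.PropositionalEquality using (_≡_; _≢_; refl; sym; trans; cong; cong₂; subst; module ≡-Reasoning)
open import Relation.Nullary using (Dec; yes; no; does; contradiction)
open import Relation.Unary using (Pred; Decidable)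

private
  variable
    A B C P Q R : Set
    k l l′ m n t v v₁ v₂ μ μ′ : ℕ

-- Indicators and sums over the entries of a vector

𝟙 : Dec P → ℕ
𝟙 p = if does p then 1 else 0

𝟙≤1 : (p : Dec P) → 𝟙 p ≤ 1
𝟙≤1 (yes _) = ≤-refl
𝟙≤1 (no _)  = z≤n

𝟙-mono : (p : Dec P) (q : Dec Q) → (P → Q) → 𝟙 p ≤ 𝟙 q
𝟙-mono (no _)  _       _ = z≤n
𝟙-mono (yes _) (yes _) _ = ≤-refl
𝟙-mono (yes x) (no ¬q) f = contradiction (f x) ¬q

𝟙-× : (p : Dec P) (q : Dec Q) (r : Dec R) → (P → Q × R) → (Q → R → P) → 𝟙 p ≡ 𝟙 q * 𝟙 r
𝟙-× (yes _)  (yes _) (yes _) _ _ = refl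
𝟙-× (yes x)  (no ¬q) _       f _ = contradiction (proj₁ (f x)) ¬q
𝟙-× (yes x)  (yes _) (no ¬r) f _ = contradiction (proj₂ (f x)) ¬r
𝟙-× (no ¬p)  (yes y) (yes z) _ g = contradiction (g y z) ¬p
𝟙-× (no _)   (yes _) (no _)  _ _ = refl
𝟙-× (no _)   (no _)  _       _ _ = refl

total : (A → ℕ) → Vec A n → ℕ
total f xs = sum (map f xs)

count≡total : {P : Pred A _} (P? : Decidable P) (xs : Vec A n) →
              count P? xs ≡ total (λ x → 𝟙 (P? x)) xs
count≡total P? []       = refl
count≡total P? (x ∷ xs) with does (P? x)
... | true  = cong suc (count≡total P? xs)
... | false = count≡total P? xs

total-cong : {f g : A → ℕ} → (∀ x → f x ≡ g x) → (xs : Vec A n) → total f xs ≡ total g xs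
total-cong f≗g xs = cong sum (map-cong f≗g xs)

total-mono : {f g : A → ℕ} → (∀ x → f x ≤ g x) → (xs : Vec A n) → total f xs ≤ total g xs
total-mono f≤g []       = z≤n
total-mono f≤g (x ∷ xs) = +-mono-≤ (f≤g x) (total-mono f≤g xs)

total-map : (f : B → ℕ) (g : A → B) (xs : Vec A n) → total f (map g xs) ≡ total (f ∘ g) xs
total-map f g xs = cong sum (sym (map-∘ f g xs))

total-++ : (f : A → ℕ) (xs : Vec A m) (ys : Vec A n) → total f (xs ++ ys) ≡ total f xs + total f ys
total-++ f xs ys = trans (cong sum (map-++ f xs ys)) (sum-++ (map f xs))

total-concat-map : (f : B → ℕ) (g : A → Vec B m) (xs : Vec A n) →
                   total f (concat (map g xs)) ≡ total (λ x → total f (g x)) xs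
total-concat-map f g []       = refl
total-concat-map f g (x ∷ xs) =
  trans (total-++ f (g x) (concat (map g xs))) (cong (total f (g x) +_) (total-concat-map f g xs))

total-*ˡ : (a : ℕ) (f : A → ℕ) (xs : Vec A n) → total (λ x → a * f x) xs ≡ a * total f xs
total-*ˡ a f []       = sym (*-zeroʳ a)
total-*ˡ a f (x ∷ xs) = trans (cong (a * f x +_) (total-*ˡ a f xs)) (sym (*-distribˡ-+ a (f x) _))

total-0 : (xs : Vec A n) → total (λ _ → 0) xs ≡ 0
total-0 []       = refl
total-0 (_ ∷ xs) = total-0 xs

total-zip-lookup : (f : A → ℕ) (g : Fin n → B) (xs : Vec A n) →
                   total (f ∘ proj₂) (tabulate (λ i → g i , lookup xs i)) ≡ total f xs
total-zip-lookup f g []       = refl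
total-zip-lookup f g (x ∷ xs) = cong (f x +_) (total-zip-lookup f (g ∘ suc) xs)

-- Matching rows

match : (U : Subset k) → Row ∣ U ∣ v → Row k v → ℕ
match U τ x = 𝟙 (≡-dec Fin._≟_ (restrict U x) τ)

occurrences≡total : (U : Subset k) (τ : Row ∣ U ∣ v) (X : Array n k v) →
                    occurrences τ (onColumns U X) ≡ total (match U τ) X
occurrences≡total U τ X =
  trans (count≡total (λ x → ≡-dec Fin._≟_ x τ) (map (restrict U) X))
        (total-map (λ x → 𝟙 (≡-dec Fin._≟_ x τ)) (restrict U) X)

restrict-zipWith : (f : A → B → C) (U : Subset k) (x : Vec A k) (y : Vec B k) →
                   restrict U (zipWith f x y) ≡ zipWith f (restrict U x) (restrict U y)
restrict-zipWith f []          []      []      = refl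
restrict-zipWith f (true  ∷ U) (a ∷ x) (b ∷ y) = cong (f a b ∷_) (restrict-zipWith f U x y)
restrict-zipWith f (false ∷ U) (a ∷ x) (b ∷ y) = restrict-zipWith f U x y

-- Rows over the product alphabet

pairRows : Row k v₁ → Row k v₂ → Row k (v₁ * v₂)
pairRows = zipWith combine

pairRows-injective : (x x′ : Row k v₁) (y y′ : Row k v₂) →
                     pairRows x y ≡ pairRows x′ y′ → x ≡ x′ × y ≡ y′
pairRows-injective []      []        []      []        _  = refl , refl
pairRows-injective (a ∷ x) (a′ ∷ x′) (b ∷ y) (b′ ∷ y′) eq =
  let ab≡ , xy≡ = ∷-injective eq
      a≡ , b≡ = Fin.combine-injective a b a′ b′ ab≡
      x≡ , y≡ = pairRows-injective x x′ y y′ xy≡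
  in cong₂ _∷_ a≡ x≡ , cong₂ _∷_ b≡ y≡

module Pairing (v₁ v₂ : ℕ) where

  firsts : Row k (v₁ * v₂) → Row k v₁
  firsts = map (quotient v₂)

  seconds : Row k (v₁ * v₂) → Row k v₂
  seconds = map (remainder {v₁} v₂)

  pairRows-firsts-seconds : (τ : Row k (v₁ * v₂)) → pairRows (firsts τ) (seconds τ) ≡ τ
  pairRows-firsts-seconds []      = refl
  pairRows-firsts-seconds (a ∷ τ) = cong₂ _∷_ (Fin.combine-remQuot {v₁} v₂ a) (pairRows-firsts-seconds τ)

  -- Restriction commutes with forming pairs and `combine` is a bijection, so matching a tuple of
  -- pairs splits into two independent conditions, whose indicators multiply.
  match-pairRows : (U : Subset k) (τ : Row ∣ U ∣ (v₁ * v₂)) (x : Row k v₁) (y : Row k v₂) →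
                   match U τ (pairRows x y) ≡ match U (firsts τ) x * match U (seconds τ) y
  match-pairRows U τ x y = 𝟙-×
    (≡-dec Fin._≟_ _ _) (≡-dec Fin._≟_ (restrict U x) _) (≡-dec Fin._≟_ (restrict U y) _)
    (λ eq → pairRows-injective _ _ _ _
              (trans (sym (restrict-zipWith combine U x y)) (trans eq (sym (pairRows-firsts-seconds τ)))))
    (λ eq₁ eq₂ → trans (restrict-zipWith combine U x y)
                   (trans (cong₂ pairRows eq₁ eq₂) (pairRows-firsts-seconds τ)))

-- Coloured COAs

inColour : Fin μ → (A → ℕ) → Fin μ × A → ℕ
inColour c f (d , x) = 𝟙 (d Fin.≟ c) * f x

-- A partition of the rows kept as a tag on each row, so that stacking is plain concatenation. The
-- simple property of a colour class is stated as a weighted sum, which avoids extracting the class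
-- as a subarray. With `N` a field, sizes need no transport until the final array.
record ColouredCOA (μ l t k v : ℕ) : Set where
  field
    {N}      : ℕ
    rows     : Vec (Fin μ × Row k v) N
    size     : N ≡ l * v ^ t
    balanced : ∀ S → Consecutive t S → ∀ τ → total (match S τ ∘ proj₂) rows ≡ l
    simple   : ∀ S S′ → Consecutive t S → Consecutive t S′ → S ≢ S′ →
               ∀ τ c → total (inColour c (match (S ∪ S′) τ)) rows ≤ 1

-- Entries outside `S` do not have colour `c` and add 0 on the left; an entry inside `S` adds at
-- most what it adds on the right.
total-inColour≤total-restrict :
  (f : A → ℕ) (χ : Fin n → Fin μ) (c : Fin μ) (S : Subset n) → (∀ i → χ i ≡ c → i ∈ S) →
  (xs : Vec A n) →
  total (inColour c f) (tabulate (λ i → χ i , lookup xs i)) ≤ total f (restrict S xs)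
total-inColour≤total-restrict f χ c []          χ⊆S []       = z≤n
total-inColour≤total-restrict f χ c (s ∷ S)     χ⊆S (x ∷ xs)
  with total-inColour≤total-restrict f (χ ∘ suc) c S
         (λ i → drop-there ∘ χ⊆S (suc i)) xs
total-inColour≤total-restrict f χ c (true  ∷ S) χ⊆S (x ∷ xs) | ih =
  +-mono-≤ (≤-trans (*-monoˡ-≤ (f x) (𝟙≤1 (χ zero Fin.≟ c))) (≤-reflexive (*-identityˡ (f x)))) ih
total-inColour≤total-restrict f χ c (false ∷ S) χ⊆S (x ∷ xs) | ih with χ zero Fin.≟ c
... | no _   = ih
... | yes eq with () ← χ⊆S zero eq

fromRowDivisible : RowDivisibleCOAExists μ l t k v → ColouredCOA μ l t k v
fromRowDivisible {μ = μ} (X , coa , P , partition , simple) = record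
  { rows     = tabulate (λ i → colour i , lookup X i)
  ; size     = refl
  ; balanced = λ S conS τ →
      trans (total-zip-lookup (match S τ) colour X)
        (trans (sym (occurrences≡total S τ X)) (IsCOA.balanced coa S conS τ))
  ; simple   = λ S S′ conS conS′ S≢S′ τ c → ≤-trans
      (total-inColour≤total-restrict (match (S ∪ S′) τ) colour c (P c)
        -- The colour of row `i` is the part that `partition` assigns to it, so colour class `c`
        -- lies inside `P c`.
        (λ { i refl → proj₁ (proj₂ (partition i)) }) X)
      (≤-trans (≤-reflexive (sym (occurrences≡total (S ∪ S′) τ (onRows (P c) X))))
        (simple c S S′ conS conS′ S≢S′ τ))
  }
  where
  colour : Fin _ → Fin μ
  colour i = proj₁ (partition i)

-- Stacking with disjoint colours

empty : ColouredCOA 0 0 t k v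
empty = record
  { rows     = []
  ; size     = refl
  ; balanced = λ _ _ _ → refl
  ; simple   = λ _ _ _ _ _ _ _ → z≤n
  }

↑ˡ≢↑ʳ : (i : Fin m) (j : Fin n) → i ↑ˡ n ≢ m ↑ʳ j
↑ˡ≢↑ʳ {m} {n} i j eq
  with () ← trans (sym (Fin.splitAt-↑ˡ m i n)) (trans (cong (splitAt m) eq) (Fin.splitAt-↑ʳ m n j))

total-inColour-rename : (g : Fin μ → Fin μ′) (c : Fin μ) (c′ : Fin μ′) → (∀ d → g d ≡ c′ → d ≡ c) →
                        (f : A → ℕ) (xs : Vec (Fin μ × A) n) →
                        total (inColour c′ f) (map (map₁ g) xs) ≤ total (inColour c f) xs
total-inColour-rename g c c′ only f xs = ≤-trans
  (≤-reflexive (total-map _ (map₁ g) xs))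
  (total-mono (λ (d , x) → *-monoˡ-≤ (f x) (𝟙-mono (g d Fin.≟ c′) (d Fin.≟ c) (only d))) xs)

total-inColour-avoid : (g : Fin μ → Fin μ′) (c′ : Fin μ′) → (∀ d → g d ≢ c′) →
                       (f : A → ℕ) (xs : Vec (Fin μ × A) n) →
                       total (inColour c′ f) (map (map₁ g) xs) ≡ 0
total-inColour-avoid g c′ avoid f xs = trans
  (total-map _ (map₁ g) xs)
  (trans (total-cong vanish xs) (total-0 xs))
  where
  vanish : ∀ p → inColour c′ f (map₁ g p) ≡ 0
  vanish (d , x) with g d Fin.≟ c′
  ... | yes eq = contradiction eq (avoid d)
  ... | no _   = refl

stack : ColouredCOA μ l t k v → ColouredCOA μ′ l′ t k v → ColouredCOA (μ + μ′) (l + l′) t k v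
stack {μ} {l} {t} {k} {v} {μ′} {l′} X Y = record
  { rows     = left ++ right
  ; size     = trans (cong₂ _+_ X.size Y.size) (sym (*-distribʳ-+ (v ^ t) l l′))
  ; balanced = λ S conS τ →
      trans (total-++ (match S τ ∘ proj₂) left right)
        (cong₂ _+_ (trans (total-map _ _ X.rows) (X.balanced S conS τ))
                   (trans (total-map _ _ Y.rows) (Y.balanced S conS τ)))
  ; simple   = λ S S′ conS conS′ S≢S′ τ c → ≤-trans
      (≤-reflexive (total-++ _ left right))
      (disjoint (match (S ∪ S′) τ) (X.simple S S′ conS conS′ S≢S′ τ) (Y.simple S S′ conS conS′ S≢S′ τ) c)
  }
  where
  module X = ColouredCOA X
  module Y = ColouredCOA Y
  left  = map (map₁ (_↑ˡ μ′)) X.rows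
  right = map (map₁ (μ ↑ʳ_)) Y.rows
  -- A colour of the stack comes from exactly one half. That half contributes at most 1 by its own
  -- simple property, and the other half has no row of this colour.
  disjoint : (f : Row k v → ℕ) →
             (∀ c → total (inColour c f) X.rows ≤ 1) → (∀ c → total (inColour c f) Y.rows ≤ 1) →
             ∀ c → total (inColour c f) left + total (inColour c f) right ≤ 1
  disjoint f leX leY c with splitAt μ c in eq
  ... | inj₁ d with refl ← Fin.splitAt⁻¹-↑ˡ {μ} {μ′} {c} eq = +-mono-≤
    (≤-trans (total-inColour-rename _ d _ (λ e → Fin.↑ˡ-injective μ′ e d) f X.rows) (leX d))
    (≤-reflexive (total-inColour-avoid _ _ (λ e eq′ → ↑ˡ≢↑ʳ d e (sym eq′)) f Y.rows))
  ... | inj₂ d with refl ← Fin.splitAt⁻¹-↑ʳ {μ} {μ′} {c} eq = +-mono-≤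
    (≤-reflexive (total-inColour-avoid _ _ (λ e → ↑ˡ≢↑ʳ e d) f X.rows))
    (≤-trans (total-inColour-rename _ d _ (λ e → Fin.↑ʳ-injective μ e d) f Y.rows) (leY d))

-- Every copy receives fresh colours, since a row repeated within one colour could break the simple
-- property. Zero copies give the empty array of index 0, which covers multiplicities `m i` equal to
-- 0.
copies : (m : ℕ) → ColouredCOA μ l t k v → ColouredCOA (m * μ) (m * l) t k v
copies zero    X = empty
copies (suc m) X = stack X (copies m X)

stackAll : (r : ℕ) (μs λs : Fin r → ℕ) → (∀ i → ColouredCOA (μs i) (λs i) t k v) →
           ColouredCOA (∑[ i < r ] μs i) (∑[ i < r ] λs i) t k v
stackAll zero    μs λs X = empty
stackAll (suc r) μs λs X = stack (X zero) (stackAll r (μs ∘ suc) (λs ∘ suc) (X ∘ suc))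

-- Superimposing a compatible family

-- Used to cut the family down to one member per colour. Compatibility is only given for distinct
-- positions, hence the injectivity of `ι`.
subfamily : (ι : Fin μ′ → Fin μ) → (∀ {i j} → ι i ≡ ι j → i ≡ j) →
            CompatibleSimpleCOAsExist μ l t k v → CompatibleSimpleCOAsExist μ′ l t k v
subfamily ι ι-inj (B , fam) = B ∘ ι , record
  { isSimpleCOA = isSimpleCOA ∘ ι
  ; compatible  = λ j j′ j≢j′ → compatible (ι j) (ι j′) (j≢j′ ∘ ι-inj)
  }
  where open IsCompatibleFamily fam

-- The hypotheses on b make it bounded by the indicator of a single colour.
total-weighted≤1 : (b : Fin μ → ℕ) → (∀ c → b c ≤ 1) → (∀ c d → c ≢ d → b c + b d ≤ 1) →
                   (f : A → ℕ) (xs : Vec (Fin μ × A) n) → (∀ c → total (inColour c f) xs ≤ 1) →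
                   total (λ (c , x) → f x * b c) xs ≤ 1
total-weighted≤1 b b≤1 b+b≤1 f xs simple with Fin.any? (λ c → b c ≟ 1)
... | yes (c , bc≡1) = ≤-trans (total-mono bound xs) (simple c)
  where
  bound : ∀ p → f (proj₂ p) * b (proj₁ p) ≤ inColour c f p
  bound (d , x) with d Fin.≟ c
  ... | yes _  = ≤-trans (*-monoʳ-≤ (f x) (b≤1 d)) (≤-reflexive (*-comm (f x) 1))
  -- Since `b c` is 1 and `b d + b c` is at most 1, `b d` must be 0.
  ... | no d≢c with b d in eq | b+b≤1 d c d≢c
  ...   | zero  | _ = ≤-reflexive (*-zeroʳ (f x))
  ...   | suc e | s≤s le =
    contradiction (≤-trans (≤-reflexive (sym bc≡1)) (≤-trans (m≤n+m (b c) e) le)) λ ()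
-- All values of `b` are at most 1 and none equals 1, so every term vanishes.
... | no ¬one = ≤-trans (≤-reflexive (trans (total-cong vanish xs) (total-0 xs))) z≤n
  where
  vanish : ∀ p → f (proj₂ p) * b (proj₁ p) ≡ 0
  vanish (d , x) with b d in eq | b≤1 d
  ... | zero        | _ = *-zeroʳ (f x)
  ... | suc zero    | _ = contradiction (d , eq) ¬one
  ... | suc (suc _) | s≤s ()

^-distribʳ-* : ∀ m n o → (m * n) ^ o ≡ m ^ o * n ^ o
^-distribʳ-* m n zero    = refl
^-distribʳ-* m n (suc o) =
  trans (cong (m * n *_) (^-distribʳ-* m n o)) (interchange m n (m ^ o) (n ^ o))

superimpose : ColouredCOA μ l t k v₁ → CompatibleSimpleCOAsExist μ m t k v₂ →
              SimpleCOAExists (m * l) t k (v₁ * v₂)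
superimpose {μ} {l} {t} {k} {v₁} {η} {v₂} X (B , fam) =
  -- The number of rows of `product` agrees with the required one only up to the equation `size`.
  subst (λ N → Array N k (v₁ * v₂)) size product , subst-simple size product
    record { isCOA = record { size = size ; balanced = balanced } ; simple = simple }
  where
  module X = ColouredCOA X
  open IsCompatibleFamily fam
  open Pairing v₁ v₂

  block : Fin μ × Row k v₁ → Array (η * v₂ ^ t) k (v₁ * v₂)
  block (c , x) = map (pairRows x) (B c)

  product : Array (X.N * (η * v₂ ^ t)) k (v₁ * v₂)
  product = concat (map block X.rows)

  size : X.N * (η * v₂ ^ t) ≡ (η * l) * (v₁ * v₂) ^ t
  size = begin
    X.N * (η * v₂ ^ t)            ≡⟨ cong (_* (η * v₂ ^ t)) X.size ⟩
    (l * v₁ ^ t) * (η * v₂ ^ t)   ≡⟨ interchange l (v₁ ^ t) η (v₂ ^ t) ⟩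
    (l * η) * (v₁ ^ t * v₂ ^ t)   ≡⟨ cong₂ _*_ (*-comm l η) (sym (^-distribʳ-* v₁ v₂ t)) ⟩
    (η * l) * (v₁ * v₂) ^ t       ∎
    where open ≡-Reasoning

  subst-simple : ∀ {N N′} (eq : N ≡ N′) (A : Array N k (v₁ * v₂)) → IsSimpleCOA (η * l) t A →
                 IsSimpleCOA (η * l) t (subst (λ N → Array N k (v₁ * v₂)) eq A)
  subst-simple refl A p = p

  -- Within the block of a row `x` of colour `c`, the indicator for `x` is constant and factors out
  -- of the sum over `B c`. Stated for arbitrary `U`, as it serves both balance and simplicity.
  occurrences-product : (U : Subset k) (τ : Row ∣ U ∣ (v₁ * v₂)) →
    occurrences τ (onColumns U product) ≡
    total (λ (c , x) → match U (firsts τ) x * occurrences (seconds τ) (onColumns U (B c))) X.rows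
  occurrences-product U τ = begin
    occurrences τ (onColumns U product)
      ≡⟨ occurrences≡total U τ product ⟩
    total (match U τ) product
      ≡⟨ total-concat-map (match U τ) block X.rows ⟩
    total (λ p → total (match U τ) (block p)) X.rows
      ≡⟨ total-cong (λ (c , x) → begin
           total (match U τ) (block (c , x))
             ≡⟨ total-map _ (pairRows x) (B c) ⟩
           total (λ y → match U τ (pairRows x y)) (B c)
             ≡⟨ total-cong (match-pairRows U τ x) (B c) ⟩
           total (λ y → match U (firsts τ) x * match U (seconds τ) y) (B c)
             ≡⟨ total-*ˡ (match U (firsts τ) x) _ (B c) ⟩
           match U (firsts τ) x * total (match U (seconds τ)) (B c)
             ≡⟨ cong (match U (firsts τ) x *_) (occurrences≡total U (seconds τ) (B c)) ⟨
           match U (firsts τ) x * occurrences (seconds τ) (onColumns U (B c)) ∎) X.rows ⟩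
    total (λ (c , x) → match U (firsts τ) x * occurrences (seconds τ) (onColumns U (B c))) X.rows ∎
    where open ≡-Reasoning

  balanced : ∀ S → Consecutive t S → ∀ τ → occurrences τ (onColumns S product) ≡ η * l
  balanced S conS τ = begin
    occurrences τ (onColumns S product)
      ≡⟨ occurrences-product S τ ⟩
    total (λ (c , x) → match S (firsts τ) x * occurrences (seconds τ) (onColumns S (B c))) X.rows
      -- On `t` consecutive columns every `B c` contains the second components exactly `η` times,
      -- whatever the colour, so the colours drop out.
      ≡⟨ total-cong (λ (c , x) → trans
           (cong (match S (firsts τ) x *_)
             (IsCOA.balanced (IsSimpleCOA.isCOA (isSimpleCOA c)) S conS (seconds τ)))
           (*-comm _ η)) X.rows ⟩
    total (λ (c , x) → η * match S (firsts τ) x) X.rows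
      ≡⟨ total-*ˡ η _ X.rows ⟩
    η * total (match S (firsts τ) ∘ proj₂) X.rows
      ≡⟨ cong (η *_) (X.balanced S conS (firsts τ)) ⟩
    η * l ∎
    where open ≡-Reasoning

  simple : HasSimpleProperty t product
  simple S S′ conS conS′ S≢S′ τ = ≤-trans (≤-reflexive (occurrences-product U τ))
    (total-weighted≤1 b
      (λ c → IsSimpleCOA.simple (isSimpleCOA c) S S′ conS conS′ S≢S′ (seconds τ))
      b+b≤1
      (match U (firsts τ)) X.rows
      (X.simple S S′ conS conS′ S≢S′ (firsts τ)))
    where
    U = S ∪ S′
    b : Fin μ → ℕ
    b c = occurrences (seconds τ) (onColumns U (B c))
    -- Occurrences in `B c` and `B d` add up to those in their superimposition, which is simple by
    -- compatibility.
    b+b≤1 : ∀ c d → c ≢ d → b c + b d ≤ 1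
    b+b≤1 c d c≢d = begin
      b c + b d
        ≡⟨ cong₂ _+_ (occurrences≡total U _ (B c)) (occurrences≡total U _ (B d)) ⟩
      total (match U (seconds τ)) (B c) + total (match U (seconds τ)) (B d)
        ≡⟨ total-++ _ (B c) (B d) ⟨
      total (match U (seconds τ)) (B c ++ B d)
        ≡⟨ occurrences≡total U _ (B c ++ B d) ⟨
      occurrences (seconds τ) (onColumns U (B c ++ B d))
        ≤⟨ IsSimpleCOA.simple (proj₂ (compatible c d c≢d)) S S′ conS conS′ S≢S′ (seconds τ) ⟩
      1 ∎
      where open ≤-Reasoning

mainTheorem13 : (t k v₁ v₂ η μ : ℕ) →
    1 ≤ t → t ≤ k → 1 ≤ v₁ → 1 ≤ v₂ → 1 ≤ η → 1 ≤ μ →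
    CompatibleSimpleCOAsExist μ η t k v₂ →
    (r : ℕ) (m μs λs : Fin r → ℕ) →
    (∀ i → 1 ≤ μs i) → (∀ i → 1 ≤ λs i) →
    (∑[ i < r ] (m i * μs i)) ≤ μ →
    (∀ i → RowDivisibleCOAExists (μs i) (λs i) t k v₁) →
    1 ≤ (∑[ i < r ] (m i * λs i)) →
    SimpleCOAExists (η * (∑[ i < r ] (m i * λs i))) t k (v₁ * v₂)
mainTheorem13 t k v₁ v₂ η μ _ _ _ _ _ _ family r m μs λs _ _ ∑mμ≤μ divisible _ =
  superimpose
    (stackAll r (λ i → m i * μs i) (λ i → m i * λs i) (λ i → copies (m i) (fromRowDivisible (divisible i))))
    -- Hypothesis (1) enters here: the colours used are matched with an initial segment of the
    -- family.
    (subfamily (λ j → inject≤ j ∑mμ≤μ) (Fin.inject≤-injective ∑mμ≤μ ∑mμ≤μ _ _) family)
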